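{- If an inequality $qS\ge 0$ is valid for $H_n$, then any zero-lift $q'S'\ge 0$ of it is valid for $H_{n+1}$.
   Context: For a positive integer $k$ let $[k]=\{1,\dots,k\}$. $K_N$ is the undirected complete graph on vertex set $[N]$, with edge set $E_N$. A weight map is a function $w:E_N\to\mathbb{R}_{\ge 0}$. For $W\subseteq[N]$, the cut $C(W)$ is the set of edges with exactly one endpoint in $W$, and $\|C(W)\|$ is the sum of the weights of its edges. For $1\le n<N$, $w$ realizes in $K_N$ the vector $S=(S_I)_{\varnothing\ne I\subseteq[n]}\in\mathbb{R}^{2^n-1}$ with $S_I=\min\{\|C(W)\| : W\subseteq[N-1],\ W\cap[n]=I\}$. $H_n$ is the set of all $S\in\mathbb{R}^{2^n-1}$ realized by some weight map in $K_N$ for some $N>n$. An inequality $qS\ge0$ with $q=(q_I)_{\varnothing\ne I\subseteq[n]}\in\mathbb{R}^{2^n-1}$ means $\sum_I q_IS_I\ge 0$; it is valid for $H_n$ if it holds for all $S\in H_n$. Zero-lift: let $K\subseteq[n]$ be the set of terminals appearing in $qS\ge0$ ($i\in K$ iff $q_I\neq0$ for some $I\ni i$). Given a family of pairwise disjoint non-empty subsets $I_i\subseteq[n+1]$, $i\in K$ (whose union need not be $[n+1]$), the corresponding zero-lift $q'S'\ge0$, an inequality over $\mathbb{R}^{2^{n+1}-1}$, is obtained by replacing each term $q_IS_I$ with $q_I\neq0$ by $q_IS'_{\bigcup_{i\in I}I_i}$. -}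

module Defs where

open import Data.Bool.Properties using () renaming (_≟_ to _≟ᵇ_)
open import Data.Fin using (Fin; toℕ) renaming (_<_ to _<ᶠ_)
open import Data.Fin.Properties using () renaming (_<?_ to _<ᶠ?_)
open import Data.Fin.Subset
  using (Subset; inside; outside; _∈_; _∉_; _∩_; ⋃; Nonempty; Empty)
open import Data.Fin.Subset.Properties using (_∈?_; nonempty?)
open import Data.Irrelevant using ([_])
open import Data.List using (List; []; _∷_; _++_; map; foldr; filter; mapMaybe;
  allFin; cartesianProduct)
open import Data.Maybe using (Maybe; just; nothing)
open import Data.Nat as ℕ using (ℕ; zero; suc)
import Data.Nat.Properties as ℕ
open import Data.Product using (Σ-syntax; ∃-syntax; _×_; _,_; proj₁; proj₂)
open import Data.Rational as ℚ using (ℚ; 0ℚ; 1ℚ; ½)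
import Data.Rational.Properties as ℚ
open import Data.Rational.Solver using (module +-*-Solver)
open import Data.Refinement using (Refinement-syntax; value; _,_)
open import Data.Sum using (_⊎_)
open import Data.Vec using ([]; _∷_; truncate)
open import Data.Vec.Properties using (≡-dec)
open import Level using (Level; 0ℓ)
open import Relation.Binary.PropositionalEquality using (_≡_; _≢_; refl; sym; trans; cong)
open import Relation.Nullary using (¬_; yes; no)
open import Relation.Nullary.Decidable using (_×-dec_; _⊎-dec_; ¬?)
open import Relation.Unary using (Pred; Decidable)

private
  variable
    a p : Level
    A : Set a
    n N : ℕ

------------------------------------------------------------------------
-- The real numbers, as Cauchy sequences of rationals. Two sequences
-- denote the same real when their difference tends to 0; this is the
-- relation _≃_, not propositional equality.

IsCauchy : Pred (ℕ → ℚ) 0ℓ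
IsCauchy x = ∀ ε → 0ℚ ℚ.< ε →
  ∃[ k ] (∀ i j → k ℕ.≤ i → k ℕ.≤ j → ℚ.∣ x i ℚ.- x j ∣ ℚ.< ε)

record ℝ : Set where
  constructor mkℝ
  field
    seq    : ℕ → ℚ
    cauchy : IsCauchy seq

open ℝ public

infix 4 _≃_ _≤_

_≃_ : ℝ → ℝ → Set
x ≃ y = ∀ ε → 0ℚ ℚ.< ε →
  ∃[ k ] (∀ i → k ℕ.≤ i → ℚ.∣ seq x i ℚ.- seq y i ∣ ℚ.< ε)

_≤_ : ℝ → ℝ → Set
x ≤ y = ∀ ε → 0ℚ ℚ.< ε →
  ∃[ k ] (∀ i → k ℕ.≤ i → seq x i ℚ.< seq y i ℚ.+ ε)

private
  open +-*-Solver

  split-+ : ∀ a b c d → (a ℚ.+ b) ℚ.- (c ℚ.+ d) ≡ (a ℚ.- c) ℚ.+ (b ℚ.- d)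
  split-+ = solve 4 (λ a b c d → (a :+ b) :- (c :+ d) := (a :- c) :+ (b :- d)) refl

  split-* : ∀ a b c d → a ℚ.* b ℚ.- c ℚ.* d ≡ a ℚ.* (b ℚ.- d) ℚ.+ (a ℚ.- c) ℚ.* d
  split-* = solve 4 (λ a b c d → a :* b :- c :* d := a :* (b :- d) :+ (a :- c) :* d) refl

  p≡p-q+q : ∀ p q → p ≡ (p ℚ.- q) ℚ.+ q
  p≡p-q+q = solve 2 (λ p q → p := (p :- q) :+ q) refl

  halves : ∀ ε → ½ ℚ.* ε ℚ.+ ½ ℚ.* ε ≡ ε
  halves ε = trans (sym (ℚ.*-distribʳ-+ ε ½ ½)) (ℚ.*-identityˡ ε)

  open ℚ.≤-Reasoning

  +-cauchy : ∀ x y → IsCauchy x → IsCauchy y → IsCauchy (λ i → x i ℚ.+ y i)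
  +-cauchy x y cx cy ε ε>0 = k ℕ.⊔ l , close
    where
    ½ε>0 : 0ℚ ℚ.< ½ ℚ.* ε
    ½ε>0 = ℚ.*-monoʳ-<-pos ½ ε>0
    k = proj₁ (cx (½ ℚ.* ε) ½ε>0)
    l = proj₁ (cy (½ ℚ.* ε) ½ε>0)
    close : ∀ i j → k ℕ.⊔ l ℕ.≤ i → k ℕ.⊔ l ℕ.≤ j →
            ℚ.∣ (x i ℚ.+ y i) ℚ.- (x j ℚ.+ y j) ∣ ℚ.< ε
    close i j ≤i ≤j = begin-strict
      ℚ.∣ (x i ℚ.+ y i) ℚ.- (x j ℚ.+ y j) ∣
        ≡⟨ cong ℚ.∣_∣ (split-+ (x i) (y i) (x j) (y j)) ⟩
      ℚ.∣ (x i ℚ.- x j) ℚ.+ (y i ℚ.- y j) ∣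
        ≤⟨ ℚ.∣p+q∣≤∣p∣+∣q∣ (x i ℚ.- x j) (y i ℚ.- y j) ⟩
      ℚ.∣ x i ℚ.- x j ∣ ℚ.+ ℚ.∣ y i ℚ.- y j ∣
        <⟨ ℚ.+-mono-<
             (proj₂ (cx (½ ℚ.* ε) ½ε>0) i j (ℕ.m⊔n≤o⇒m≤o k l ≤i) (ℕ.m⊔n≤o⇒m≤o k l ≤j))
             (proj₂ (cy (½ ℚ.* ε) ½ε>0) i j (ℕ.m⊔n≤o⇒n≤o k l ≤i) (ℕ.m⊔n≤o⇒n≤o k l ≤j)) ⟩
      ½ ℚ.* ε ℚ.+ ½ ℚ.* ε
        ≡⟨ halves ε ⟩
      ε ∎

  bounded : ∀ x → IsCauchy x →
            ∃[ b ] 0ℚ ℚ.< b × ∃[ k ] (∀ i → k ℕ.≤ i → ℚ.∣ x i ∣ ℚ.≤ b)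
  bounded x cx = b , b>0 , k , below
    where
    1>0 : 0ℚ ℚ.< 1ℚ
    1>0 = ℚ.positive⁻¹ 1ℚ
    k = proj₁ (cx 1ℚ 1>0)
    b = 1ℚ ℚ.+ ℚ.∣ x k ∣
    b>0 : 0ℚ ℚ.< b
    b>0 = ℚ.+-mono-<-≤ 1>0 (ℚ.0≤∣p∣ (x k))
    below : ∀ i → k ℕ.≤ i → ℚ.∣ x i ∣ ℚ.≤ b
    below i k≤i = begin
      ℚ.∣ x i ∣
        ≡⟨ cong ℚ.∣_∣ (p≡p-q+q (x i) (x k)) ⟩
      ℚ.∣ (x i ℚ.- x k) ℚ.+ x k ∣
        ≤⟨ ℚ.∣p+q∣≤∣p∣+∣q∣ (x i ℚ.- x k) (x k) ⟩
      ℚ.∣ x i ℚ.- x k ∣ ℚ.+ ℚ.∣ x k ∣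
        ≤⟨ ℚ.+-monoˡ-≤ ℚ.∣ x k ∣ (ℚ.<⇒≤ (proj₂ (cx 1ℚ 1>0) i k k≤i ℕ.≤-refl)) ⟩
      b ∎

  scale : ∀ d → 0ℚ ℚ.< d → ∀ ε → 0ℚ ℚ.< ε → ∃[ δ ] 0ℚ ℚ.< δ × d ℚ.* δ ≡ ε
  scale d d>0 ε ε>0 = ℚ.1/ d ℚ.* ε , δ>0 , d*δ≡ε
    where
    instance
      d-pos = ℚ.positive d>0
      d≢0   = ℚ.pos⇒nonZero d
    δ>0 : 0ℚ ℚ.< ℚ.1/ d ℚ.* ε
    δ>0 = ℚ.positive⁻¹ _ {{ℚ.pos*pos⇒pos (ℚ.1/ d) {{ℚ.1/pos⇒pos d}} ε {{ℚ.positive ε>0}}}}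
    d*δ≡ε : d ℚ.* (ℚ.1/ d ℚ.* ε) ≡ ε
    d*δ≡ε = trans (sym (ℚ.*-assoc d (ℚ.1/ d) ε))
           (trans (cong (ℚ._* ε) (ℚ.*-inverseʳ d)) (ℚ.*-identityˡ ε))

  ∣p*q∣<b*δ : ∀ b δ p q → 0ℚ ℚ.< b → ℚ.∣ p ∣ ℚ.≤ b → ℚ.∣ q ∣ ℚ.< δ → ℚ.∣ p ℚ.* q ∣ ℚ.< b ℚ.* δ
  ∣p*q∣<b*δ b δ p q b>0 p≤b q<δ = begin-strict
    ℚ.∣ p ℚ.* q ∣         ≡⟨ ℚ.∣p*q∣≡∣p∣*∣q∣ p q ⟩
    ℚ.∣ p ∣ ℚ.* ℚ.∣ q ∣   ≤⟨ ℚ.*-monoʳ-≤-nonNeg ℚ.∣ q ∣ {{ℚ.∣-∣-nonNeg q}} p≤b ⟩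
    b ℚ.* ℚ.∣ q ∣         <⟨ ℚ.*-monoʳ-<-pos b {{ℚ.positive b>0}} q<δ ⟩
    b ℚ.* δ               ∎

  *-cauchy : ∀ x y → IsCauchy x → IsCauchy y → IsCauchy (λ i → x i ℚ.* y i)
  *-cauchy x y cx cy ε ε>0 =
    let b , b>0 , k₁ , x≤b = bounded x cx
        c , c>0 , k₂ , y≤c = bounded y cy
        δ , δ>0 , d*δ≡ε    = scale (b ℚ.+ c) (ℚ.+-mono-< b>0 c>0) ε ε>0
        k₃ , x<δ           = cx δ δ>0
        k₄ , y<δ           = cy δ δ>0
    in (k₁ ℕ.⊔ k₂) ℕ.⊔ (k₃ ℕ.⊔ k₄) , λ i j ≤i ≤j →
      let k₁₂≤i = ℕ.m⊔n≤o⇒m≤o (k₁ ℕ.⊔ k₂) (k₃ ℕ.⊔ k₄) ≤i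
          k₁₂≤j = ℕ.m⊔n≤o⇒m≤o (k₁ ℕ.⊔ k₂) (k₃ ℕ.⊔ k₄) ≤j
          k₃₄≤i = ℕ.m⊔n≤o⇒n≤o (k₁ ℕ.⊔ k₂) (k₃ ℕ.⊔ k₄) ≤i
          k₃₄≤j = ℕ.m⊔n≤o⇒n≤o (k₁ ℕ.⊔ k₂) (k₃ ℕ.⊔ k₄) ≤j
      in begin-strict
      ℚ.∣ x i ℚ.* y i ℚ.- x j ℚ.* y j ∣
        ≡⟨ cong ℚ.∣_∣ (split-* (x i) (y i) (x j) (y j)) ⟩
      ℚ.∣ x i ℚ.* (y i ℚ.- y j) ℚ.+ (x i ℚ.- x j) ℚ.* y j ∣
        ≤⟨ ℚ.∣p+q∣≤∣p∣+∣q∣ (x i ℚ.* (y i ℚ.- y j)) ((x i ℚ.- x j) ℚ.* y j) ⟩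
      ℚ.∣ x i ℚ.* (y i ℚ.- y j) ∣ ℚ.+ ℚ.∣ (x i ℚ.- x j) ℚ.* y j ∣
        ≡⟨ cong (λ z → ℚ.∣ x i ℚ.* (y i ℚ.- y j) ∣ ℚ.+ ℚ.∣ z ∣) (ℚ.*-comm (x i ℚ.- x j) (y j)) ⟩
      ℚ.∣ x i ℚ.* (y i ℚ.- y j) ∣ ℚ.+ ℚ.∣ y j ℚ.* (x i ℚ.- x j) ∣
        <⟨ ℚ.+-mono-<
             (∣p*q∣<b*δ b δ (x i) (y i ℚ.- y j) b>0 (x≤b i (ℕ.m⊔n≤o⇒m≤o k₁ k₂ k₁₂≤i))
               (y<δ i j (ℕ.m⊔n≤o⇒n≤o k₃ k₄ k₃₄≤i) (ℕ.m⊔n≤o⇒n≤o k₃ k₄ k₃₄≤j)))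
             (∣p*q∣<b*δ c δ (y j) (x i ℚ.- x j) c>0 (y≤c j (ℕ.m⊔n≤o⇒n≤o k₁ k₂ k₁₂≤j))
               (x<δ i j (ℕ.m⊔n≤o⇒m≤o k₃ k₄ k₃₄≤i) (ℕ.m⊔n≤o⇒m≤o k₃ k₄ k₃₄≤j))) ⟩
      b ℚ.* δ ℚ.+ c ℚ.* δ
        ≡⟨ ℚ.*-distribʳ-+ δ b c ⟨
      (b ℚ.+ c) ℚ.* δ
        ≡⟨ d*δ≡ε ⟩
      ε ∎

0ℝ : ℝ
0ℝ = mkℝ (λ _ → 0ℚ) (λ _ ε>0 → 0 , λ _ _ _ _ → ε>0)

infixl 6 _+_
infixl 7 _*_

_+_ : ℝ → ℝ → ℝ
mkℝ x cx + mkℝ y cy = mkℝ (λ i → x i ℚ.+ y i) (+-cauchy x y cx cy)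

_*_ : ℝ → ℝ → ℝ
mkℝ x cx * mkℝ y cy = mkℝ (λ i → x i ℚ.* y i) (*-cauchy x y cx cy)

∑ : List A → (A → ℝ) → ℝ
∑ xs f = foldr (λ x s → f x + s) 0ℝ xs

-- m = min { f x : P x }

IsMin : {A : Set} → Pred A 0ℓ → (A → ℝ) → ℝ → Set
IsMin P f m = (∃[ x ] P x × m ≃ f x) × (∀ x → P x → m ≤ f x)

------------------------------------------------------------------------
-- Enumerations of finite sets

refine : {P : Pred A p} → Decidable P → List A → List [ x ∈ A ∣ P x ]
refine {A = A} {P = P} P? = mapMaybe check
  where
  check : A → Maybe [ x ∈ A ∣ P x ]
  check x with P? x
  ... | yes px = just (x , [ px ])
  ... | no  _  = nothing

subsets : ∀ n → List (Subset n)
subsets zero    = [] ∷ []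
subsets (suc n) = map (outside ∷_) (subsets n) ++ map (inside ∷_) (subsets n)

NonemptySubset : ℕ → Set
NonemptySubset n = [ I ∈ Subset n ∣ Nonempty I ]

nonemptySubsets : ∀ n → List (NonemptySubset n)
nonemptySubsets n = refine nonempty? (subsets n)

------------------------------------------------------------------------
-- Weighted complete graphs and their cuts. The vertices 1, …, N are the
-- elements of Fin N in order; in particular vertex N is the last one.

-- An undirected edge is represented by its endpoints in increasing order.

Edge : ℕ → Set
Edge N = [ e ∈ Fin N × Fin N ∣ proj₁ e <ᶠ proj₂ e ]

edges : ∀ N → List (Edge N)
edges N = refine (λ e → proj₁ e <ᶠ? proj₂ e) (cartesianProduct (allFin N) (allFin N))

record WeightMap (N : ℕ) : Set where
  field
    weight : Edge N → ℝ
    nonNeg : ∀ e → 0ℝ ≤ weight e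

open WeightMap public

Cut : Subset N → Pred (Edge N) 0ℓ
Cut W ((u , v) , _) = (u ∈ W × v ∉ W) ⊎ (u ∉ W × v ∈ W)

cut? : (W : Subset N) → Decidable (Cut W)
cut? W ((u , v) , _) = (u ∈? W ×-dec ¬? (v ∈? W)) ⊎-dec (¬? (u ∈? W) ×-dec v ∈? W)

cutWeight : WeightMap N → Subset N → ℝ
cutWeight {N} w W = ∑ (filter (cut? W) (edges N)) (weight w)

------------------------------------------------------------------------
-- The set H_n

Vector : ℕ → Set
Vector n = NonemptySubset n → ℝ

-- W ⊆ [N - 1] and W ∩ [n] = I. The element v : Fin N is vertex 1 + toℕ v,
-- and truncate keeps the membership of the first n vertices.

Admissible : n ℕ.< N → Subset n → Pred (Subset N) 0ℓ
Admissible {N = N} n<N I W =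
  (∀ v → v ∈ W → suc (toℕ v) ℕ.< N) × truncate (ℕ.<⇒≤ n<N) W ≡ I

Realizes : n ℕ.< N → WeightMap N → Pred (Vector n) 0ℓ
Realizes n<N w S = ∀ I → IsMin (Admissible n<N (value I)) (cutWeight w) (S I)

H : ∀ n → Pred (Vector n) 0ℓ
H n S = ∃[ N ] Σ[ n<N ∈ n ℕ.< N ] ∃[ w ] Realizes n<N w S

------------------------------------------------------------------------
-- Inequalities and zero-lifts

Valid : ∀ n → Pred (Vector n) 0ℓ
Valid n q = ∀ S → H n S → 0ℝ ≤ ∑ (nonemptySubsets n) (λ I → q I * S I)

Appears : Vector n → Pred (Fin n) 0ℓ
Appears q i = ∃[ I ] i ∈ value I × ¬ q I ≃ 0ℝ

-- The values of family at terminals which do not appear are irrelevant: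
-- they only enter terms whose coefficient is zero.

record LiftFamily (q : Vector n) : Set where
  field
    family   : Fin n → Subset (suc n)
    nonempty : ∀ i → Appears q i → Nonempty (family i)
    disjoint : ∀ i j → Appears q i → Appears q j → i ≢ j → Empty (family i ∩ family j)

open LiftFamily public

⋃[_]_ : Subset n → (Fin n → Subset N) → Subset N
⋃[_]_ {n} I F = ⋃ (map F (filter (_∈? I) (allFin n)))

-- The coefficient of S′_J after every q_I S_I is replaced by q_I S′_(⋃ I_i).
-- Summing over all I, rather than those with q_I ≠ 0, only adds zeros. For
-- q_I ≠ 0 the unions are non-empty and pairwise distinct, so that no term is
-- lost and no two of them are merged.

zeroLift : (q : Vector n) → LiftFamily q → Vector (suc n)
zeroLift {n} q F J =
  ∑ (filter (λ I → ≡-dec _≟ᵇ_ (⋃[ value I ] family F) (value J)) (nonemptySubsets n)) q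

{-# OPTIONS --safe #-}
module Submission where

-- Let S′ ∈ H (suc n) be realized by w in K_N. Contract, for every terminal i
-- which appears in q, the set I_i to the new terminal i, and every other old
-- terminal to the sink N; the remaining vertices stay. Terminals which do not
-- appear in q become isolated. Cuts of the contracted graph are the cuts of the
-- old one which respect the contraction, so it realizes the vector
-- S_I = S′_(⋃ I_i) (read as 0 when the union is empty), and q′S′ = qS ≥ 0.
-- Whether a coefficient vanishes is undecidable, but 0ℝ ≤ x is stable under
-- double negation, so the case distinction may be made all the same.

open import Defs
open import Algebra.Bundles using (CommutativeMonoid)
import Algebra.Properties.CommutativeSemigroup as CommutativeSemigroup
open import Data.Bool using (if_then_else_)
open import Data.Bool.Properties using (¬-not) renaming (_≟_ to _≟ᵇ_)
open import Data.Fin using (Fin; toℕ; fromℕ; fromℕ<; inject≤)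
open import Data.Fin.Properties as Fin
  using (toℕ-injective; toℕ-fromℕ; toℕ-fromℕ<; toℕ-inject≤; toℕ<n; sequence)
  renaming (_<?_ to _<ᶠ?_)
open import Data.Fin.Subset using (Subset; Side; inside; outside; _∈_; _∉_; ⊥; ⋃; Nonempty)
open import Data.Fin.Subset.Properties
  using (_∈?_; nonempty?; ∉⊥; Empty-unique; ⊆-antisym; x∈p∪q⁺; x∈p∪q⁻; x∈p∩q⁺)
open import Data.Irrelevant using ([_])
open import Data.List using (List; []; _∷_; map; filter; allFin)
import Data.List.Membership.Propositional as List
open import Data.List.Membership.Propositional.Properties
  using (∈-filter⁺; ∈-filter⁻; ∈-map⁺; ∈-map⁻; ∈-++⁺ˡ; ∈-++⁺ʳ; ∈-allFin; ∈-cartesianProduct⁺)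
open import Data.List.Properties using (filter-none)
open import Data.List.Relation.Binary.Disjoint.Propositional using (Disjoint)
open import Data.List.Relation.Unary.All as All using (All; []; _∷_)
open import Data.List.Relation.Unary.AllPairs using ([]; _∷_)
open import Data.List.Relation.Unary.Any using (here; there)
open import Data.List.Relation.Unary.Unique.Propositional using (Unique)
import Data.List.Relation.Unary.Unique.Propositional.Properties as Unique
open import Data.Maybe using (Maybe; just; nothing; maybe)
open import Data.Nat as ℕ using (ℕ; zero; suc; _<_) renaming (_≤_ to _≤ℕ_)
import Data.Nat.Properties as ℕ
open import Data.Product using (∃-syntax; _×_; _,_; proj₁; proj₂; map₂)
open import Data.Rational as ℚ using (ℚ; 0ℚ; 1ℚ; ½)
import Data.Rational.Properties as ℚ
open import Data.Rational.Solver using (module +-*-Solver)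
open import Data.Refinement using (value; _,_; value-injective)
open import Data.Sum using (_⊎_; inj₁; inj₂)
open import Data.Vec using ([]; _∷_; lookup; tabulate; truncate)
open import Data.Vec.Properties
  using (lookup∘tabulate; tabulate∘lookup; tabulate-cong; lookup-truncate; []=⇒lookup; lookup⇒[]=;
         ≡-dec; ∷-injectiveʳ)
open import Effect.Monad using (RawMonad)
open import Function using (_∘_; mk⇔; _⇔_)
open import Level using (Level)
open import Relation.Binary.Definitions using (tri<; tri≈; tri>)
open import Relation.Binary.PropositionalEquality
open import Relation.Nullary using (Dec; does; yes; no; ¬_; contradiction)
open import Relation.Nullary.Decidable
  using (_×-dec_; _⊎-dec_; dec-true; dec-false; does-⇔; ¬¬-excluded-middle)
open import Relation.Nullary.Negation using (¬¬-Monad; ¬¬-map; negated-stable; contradiction-irr)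
open import Relation.Unary using (Pred; Decidable)

private
  variable
    a b p : Level
    A : Set a
    B : Set b
    M N m n : ℕ
    x y z x′ y′ : ℝ

-- Cauchy reals

infix 4 _≐_

-- Finer than `_≃_`: the identities between finite sums below hold at every index, so they reduce to
-- arithmetic in `ℚ`.
_≐_ : ℝ → ℝ → Set
x ≐ y = ∀ i → seq x i ≡ seq y i

p≤∣p∣ : ∀ p → p ℚ.≤ ℚ.∣ p ∣
p≤∣p∣ p with ℚ.≤-total 0ℚ p
... | inj₁ 0≤p = ℚ.≤-reflexive (sym (ℚ.0≤p⇒∣p∣≡p 0≤p))
... | inj₂ p≤0 = ℚ.≤-trans p≤0 (ℚ.0≤∣p∣ p)

∣p-q∣≡∣q-p∣ : ∀ p q → ℚ.∣ p ℚ.- q ∣ ≡ ℚ.∣ q ℚ.- p ∣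
∣p-q∣≡∣q-p∣ p q = trans (cong ℚ.∣_∣ (swap p q)) (ℚ.∣-p∣≡∣p∣ (q ℚ.- p))
  where
  open +-*-Solver
  swap : ∀ p q → p ℚ.- q ≡ ℚ.- (q ℚ.- p)
  swap = solve 2 (λ p q → p :- q := :- (q :- p)) refl

∣p-q∣<ε⇒p<q+ε : ∀ p q {ε} → ℚ.∣ p ℚ.- q ∣ ℚ.< ε → p ℚ.< q ℚ.+ ε
∣p-q∣<ε⇒p<q+ε p q {ε} <ε = begin-strict
  p                        ≡⟨ split p q ⟩
  q ℚ.+ (p ℚ.- q)          ≤⟨ ℚ.+-monoʳ-≤ q (p≤∣p∣ (p ℚ.- q)) ⟩
  q ℚ.+ ℚ.∣ p ℚ.- q ∣      <⟨ ℚ.+-monoʳ-< q <ε ⟩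
  q ℚ.+ ε                  ∎
  where
  open ℚ.≤-Reasoning
  open +-*-Solver
  split : ∀ p q → p ≡ q ℚ.+ (p ℚ.- q)
  split = solve 2 (λ p q → p := q :+ (p :- q)) refl

½*ε>0 : ∀ {ε} → 0ℚ ℚ.< ε → 0ℚ ℚ.< ½ ℚ.* ε
½*ε>0 = ℚ.*-monoʳ-<-pos ½

½*ε+½*ε≡ε : ∀ ε → ½ ℚ.* ε ℚ.+ ½ ℚ.* ε ≡ ε
½*ε+½*ε≡ε ε = trans (sym (ℚ.*-distribʳ-+ ε ½ ½)) (ℚ.*-identityˡ ε)

≐⇒≃ : x ≐ y → x ≃ y
≐⇒≃ {x} {y} x≐y ε ε>0 = 0 , λ i _ → subst (ℚ._< ε) (sym (distance i)) ε>0
  where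
  distance : ∀ i → ℚ.∣ seq x i ℚ.- seq y i ∣ ≡ 0ℚ
  distance i = cong ℚ.∣_∣ (trans (cong (ℚ._- seq y i) (x≐y i)) (ℚ.+-inverseʳ (seq y i)))

≃-refl : x ≃ x
≃-refl {x} = ≐⇒≃ {x} {x} (λ _ → refl)

≃-sym : x ≃ y → y ≃ x
≃-sym {x} {y} x≃y ε ε>0 = map₂
  (λ close i k≤i → subst (ℚ._< ε) (∣p-q∣≡∣q-p∣ (seq x i) (seq y i)) (close i k≤i))
  (x≃y ε ε>0)

≃-trans : x ≃ y → y ≃ z → x ≃ z
≃-trans {x} {y} {z} x≃y y≃z ε ε>0 =
  let k , x<y = x≃y (½ ℚ.* ε) (½*ε>0 ε>0)
      l , y<z = y≃z (½ ℚ.* ε) (½*ε>0 ε>0)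
  in k ℕ.⊔ l , λ i k⊔l≤i → begin-strict
    ℚ.∣ seq x i ℚ.- seq z i ∣
      ≡⟨ cong ℚ.∣_∣ (split (seq x i) (seq y i) (seq z i)) ⟩
    ℚ.∣ (seq x i ℚ.- seq y i) ℚ.+ (seq y i ℚ.- seq z i) ∣
      ≤⟨ ℚ.∣p+q∣≤∣p∣+∣q∣ (seq x i ℚ.- seq y i) (seq y i ℚ.- seq z i) ⟩
    ℚ.∣ seq x i ℚ.- seq y i ∣ ℚ.+ ℚ.∣ seq y i ℚ.- seq z i ∣
      <⟨ ℚ.+-mono-< (x<y i (ℕ.m⊔n≤o⇒m≤o k l k⊔l≤i)) (y<z i (ℕ.m⊔n≤o⇒n≤o k l k⊔l≤i)) ⟩
    ½ ℚ.* ε ℚ.+ ½ ℚ.* ε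
      ≡⟨ ½*ε+½*ε≡ε ε ⟩
    ε ∎
  where
  open ℚ.≤-Reasoning
  open +-*-Solver
  split : ∀ p q r → p ℚ.- r ≡ (p ℚ.- q) ℚ.+ (q ℚ.- r)
  split = solve 3 (λ p q r → p :- r := (p :- q) :+ (q :- r)) refl

+-cong : x ≃ x′ → y ≃ y′ → x + y ≃ x′ + y′
+-cong {x} {x′} {y} {y′} x≃x′ y≃y′ ε ε>0 =
  let k , x<x′ = x≃x′ (½ ℚ.* ε) (½*ε>0 ε>0)
      l , y<y′ = y≃y′ (½ ℚ.* ε) (½*ε>0 ε>0)
  in k ℕ.⊔ l , λ i k⊔l≤i → begin-strict
    ℚ.∣ (seq x i ℚ.+ seq y i) ℚ.- (seq x′ i ℚ.+ seq y′ i) ∣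
      ≡⟨ cong ℚ.∣_∣ (split (seq x i) (seq y i) (seq x′ i) (seq y′ i)) ⟩
    ℚ.∣ (seq x i ℚ.- seq x′ i) ℚ.+ (seq y i ℚ.- seq y′ i) ∣
      ≤⟨ ℚ.∣p+q∣≤∣p∣+∣q∣ (seq x i ℚ.- seq x′ i) (seq y i ℚ.- seq y′ i) ⟩
    ℚ.∣ seq x i ℚ.- seq x′ i ∣ ℚ.+ ℚ.∣ seq y i ℚ.- seq y′ i ∣
      <⟨ ℚ.+-mono-< (x<x′ i (ℕ.m⊔n≤o⇒m≤o k l k⊔l≤i)) (y<y′ i (ℕ.m⊔n≤o⇒n≤o k l k⊔l≤i)) ⟩
    ½ ℚ.* ε ℚ.+ ½ ℚ.* ε
      ≡⟨ ½*ε+½*ε≡ε ε ⟩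
    ε ∎
  where
  open ℚ.≤-Reasoning
  open +-*-Solver
  split : ∀ p q r s → (p ℚ.+ q) ℚ.- (r ℚ.+ s) ≡ (p ℚ.- r) ℚ.+ (q ℚ.- s)
  split = solve 4 (λ p q r s → (p :+ q) :- (r :+ s) := (p :- r) :+ (q :- s)) refl

eventually-bounded : ∀ x → ∃[ b ] 0ℚ ℚ.< b × ∃[ k ] (∀ i → k ℕ.≤ i → ℚ.∣ seq x i ∣ ℚ.≤ b)
eventually-bounded x = 1ℚ ℚ.+ ℚ.∣ seq x k ∣ , b>0 , k , below
  where
  open ℚ.≤-Reasoning
  open +-*-Solver using (solve; _:=_; _:+_; _:-_)
  k = proj₁ (cauchy x 1ℚ (ℚ.positive⁻¹ 1ℚ))
  b>0 = ℚ.+-mono-<-≤ (ℚ.positive⁻¹ 1ℚ) (ℚ.0≤∣p∣ (seq x k))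
  split : ∀ p q → p ≡ (p ℚ.- q) ℚ.+ q
  split = solve 2 (λ p q → p := (p :- q) :+ q) refl
  below : ∀ i → k ℕ.≤ i → ℚ.∣ seq x i ∣ ℚ.≤ 1ℚ ℚ.+ ℚ.∣ seq x k ∣
  below i k≤i = begin
    ℚ.∣ seq x i ∣
      ≡⟨ cong ℚ.∣_∣ (split (seq x i) (seq x k)) ⟩
    ℚ.∣ (seq x i ℚ.- seq x k) ℚ.+ seq x k ∣
      ≤⟨ ℚ.∣p+q∣≤∣p∣+∣q∣ (seq x i ℚ.- seq x k) (seq x k) ⟩
    ℚ.∣ seq x i ℚ.- seq x k ∣ ℚ.+ ℚ.∣ seq x k ∣
      ≤⟨ ℚ.+-monoˡ-≤ ℚ.∣ seq x k ∣
           (ℚ.<⇒≤ (proj₂ (cauchy x 1ℚ (ℚ.positive⁻¹ 1ℚ)) i k k≤i ℕ.≤-refl)) ⟩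
    1ℚ ℚ.+ ℚ.∣ seq x k ∣ ∎

*-zeroˡ : x ≃ 0ℝ → x * y ≃ 0ℝ
*-zeroˡ {x} {y} x≃0 ε ε>0 =
  let b , b>0 , k , y≤b = eventually-bounded y
      instance
        b-pos = ℚ.positive b>0
        b≢0   = ℚ.pos⇒nonZero b
      -- Eventually `y` is at most `b` in absolute value, so making `x` smaller than `ε / b` keeps
      -- the product below `ε`.
      δ     = ℚ.1/ b ℚ.* ε
      δ>0   = ℚ.positive⁻¹ δ {{ℚ.pos*pos⇒pos (ℚ.1/ b) {{ℚ.1/pos⇒pos b}} ε {{ℚ.positive ε>0}}}}
      l , x<δ = x≃0 δ δ>0
  in k ℕ.⊔ l , λ i k⊔l≤i → begin-strict
    ℚ.∣ seq x i ℚ.* seq y i ℚ.- 0ℚ ∣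
      ≡⟨ cong ℚ.∣_∣ (rearrange (seq x i) (seq y i)) ⟩
    ℚ.∣ seq y i ℚ.* (seq x i ℚ.- 0ℚ) ∣
      ≡⟨ ℚ.∣p*q∣≡∣p∣*∣q∣ (seq y i) (seq x i ℚ.- 0ℚ) ⟩
    ℚ.∣ seq y i ∣ ℚ.* ℚ.∣ seq x i ℚ.- 0ℚ ∣
      ≤⟨ ℚ.*-monoʳ-≤-nonNeg ℚ.∣ seq x i ℚ.- 0ℚ ∣ {{ℚ.∣-∣-nonNeg (seq x i ℚ.- 0ℚ)}}
           (y≤b i (ℕ.m⊔n≤o⇒m≤o k l k⊔l≤i)) ⟩
    b ℚ.* ℚ.∣ seq x i ℚ.- 0ℚ ∣
      <⟨ ℚ.*-monoʳ-<-pos b (x<δ i (ℕ.m⊔n≤o⇒n≤o k l k⊔l≤i)) ⟩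
    b ℚ.* (ℚ.1/ b ℚ.* ε)
      ≡⟨ ℚ.*-assoc b (ℚ.1/ b) ε ⟨
    b ℚ.* ℚ.1/ b ℚ.* ε
      ≡⟨ cong (ℚ._* ε) (ℚ.*-inverseʳ b) ⟩
    1ℚ ℚ.* ε
      ≡⟨ ℚ.*-identityˡ ε ⟩
    ε ∎
  where
  open ℚ.≤-Reasoning
  open +-*-Solver using (solve; _:=_; _:*_; _:-_; con)
  rearrange : ∀ p q → p ℚ.* q ℚ.- 0ℚ ≡ q ℚ.* (p ℚ.- 0ℚ)
  rearrange = solve 2 (λ p q → p :* q :- con 0ℚ := q :* (p :- con 0ℚ)) refl

≤-respʳ-≐ : y ≐ z → x ≤ y → x ≤ z
≤-respʳ-≐ {x = x} y≐z x≤y ε ε>0 =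
  map₂ (λ below i k≤i → subst (λ t → seq x i ℚ.< t ℚ.+ ε) (y≐z i) (below i k≤i)) (x≤y ε ε>0)

≤-respʳ-≃ : y ≃ z → x ≤ y → x ≤ z
≤-respʳ-≃ {y} {z} {x} y≃z x≤y ε ε>0 =
  let k , y<z = y≃z (½ ℚ.* ε) (½*ε>0 ε>0)
      l , x<y = x≤y (½ ℚ.* ε) (½*ε>0 ε>0)
  in k ℕ.⊔ l , λ i k⊔l≤i → begin-strict
    seq x i
      <⟨ x<y i (ℕ.m⊔n≤o⇒n≤o k l k⊔l≤i) ⟩
    seq y i ℚ.+ ½ ℚ.* ε
      <⟨ ℚ.+-monoˡ-< (½ ℚ.* ε)
           (∣p-q∣<ε⇒p<q+ε (seq y i) (seq z i) (y<z i (ℕ.m⊔n≤o⇒m≤o k l k⊔l≤i))) ⟩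
    seq z i ℚ.+ ½ ℚ.* ε ℚ.+ ½ ℚ.* ε
      ≡⟨ ℚ.+-assoc (seq z i) (½ ℚ.* ε) (½ ℚ.* ε) ⟩
    seq z i ℚ.+ (½ ℚ.* ε ℚ.+ ½ ℚ.* ε)
      ≡⟨ cong (seq z i ℚ.+_) (½*ε+½*ε≡ε ε) ⟩
    seq z i ℚ.+ ε ∎
  where open ℚ.≤-Reasoning

+-nonNeg : 0ℝ ≤ x → 0ℝ ≤ y → 0ℝ ≤ x + y
+-nonNeg {x} {y} 0≤x 0≤y ε ε>0 =
  let k , 0<x = 0≤x (½ ℚ.* ε) (½*ε>0 ε>0)
      l , 0<y = 0≤y (½ ℚ.* ε) (½*ε>0 ε>0)
  in k ℕ.⊔ l , λ i k⊔l≤i → begin-strict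
    0ℚ
      <⟨ ℚ.+-mono-< (0<x i (ℕ.m⊔n≤o⇒m≤o k l k⊔l≤i)) (0<y i (ℕ.m⊔n≤o⇒n≤o k l k⊔l≤i)) ⟩
    (seq x i ℚ.+ ½ ℚ.* ε) ℚ.+ (seq y i ℚ.+ ½ ℚ.* ε)
      ≡⟨ regroup (seq x i) (seq y i) (½ ℚ.* ε) ⟩
    seq x i ℚ.+ seq y i ℚ.+ (½ ℚ.* ε ℚ.+ ½ ℚ.* ε)
      ≡⟨ cong (seq x i ℚ.+ seq y i ℚ.+_) (½*ε+½*ε≡ε ε) ⟩
    seq x i ℚ.+ seq y i ℚ.+ ε ∎
  where
  open ℚ.≤-Reasoning
  open +-*-Solver
  regroup : ∀ p q h → (p ℚ.+ h) ℚ.+ (q ℚ.+ h) ≡ p ℚ.+ q ℚ.+ (h ℚ.+ h)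
  regroup = solve 3 (λ p q h → (p :+ h) :+ (q :+ h) := p :+ q :+ (h :+ h)) refl

∑-nonNeg : (f : A → ℝ) → (∀ x → 0ℝ ≤ f x) → ∀ xs → 0ℝ ≤ ∑ xs f
∑-nonNeg f 0≤f []       = λ ε ε>0 → 0 , λ _ _ → subst (0ℚ ℚ.<_) (sym (ℚ.+-identityˡ ε)) ε>0
∑-nonNeg f 0≤f (x ∷ xs) = +-nonNeg {f x} {∑ xs f} (0≤f x) (∑-nonNeg f 0≤f xs)

-- Beyond `k` the sequence moves by less than `ε/4`, and the sign of `seq x k + ε/2` is a decidable
-- question about rationals. If it is positive, all later terms exceed `-ε`; if not, `0ℝ ≤ x` is
-- refuted, against the hypothesis.
0≤-stable : ¬ ¬ 0ℝ ≤ x → 0ℝ ≤ x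
0≤-stable {x} ¬¬0≤x ε ε>0 with cauchy x (½ ℚ.* (½ ℚ.* ε)) (½*ε>0 (½*ε>0 ε>0))
... | k , close with 0ℚ ℚ.<? seq x k ℚ.+ ½ ℚ.* ε
...   | yes 0<xₖ+½ε = k , λ i k≤i → begin-strict
  0ℚ
    <⟨ 0<xₖ+½ε ⟩
  seq x k ℚ.+ ½ ℚ.* ε
    <⟨ ℚ.+-monoˡ-< (½ ℚ.* ε) (∣p-q∣<ε⇒p<q+ε (seq x k) (seq x i) (close k i ℕ.≤-refl k≤i)) ⟩
  seq x i ℚ.+ ½ ℚ.* (½ ℚ.* ε) ℚ.+ ½ ℚ.* ε
    <⟨ ℚ.+-monoˡ-< (½ ℚ.* ε) (ℚ.+-monoʳ-< (seq x i) ¼ε<½ε) ⟩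
  seq x i ℚ.+ ½ ℚ.* ε ℚ.+ ½ ℚ.* ε
    ≡⟨ ℚ.+-assoc (seq x i) (½ ℚ.* ε) (½ ℚ.* ε) ⟩
  seq x i ℚ.+ (½ ℚ.* ε ℚ.+ ½ ℚ.* ε)
    ≡⟨ cong (seq x i ℚ.+_) (½*ε+½*ε≡ε ε) ⟩
  seq x i ℚ.+ ε ∎
  where
  open ℚ.≤-Reasoning
  ¼ε<½ε : ½ ℚ.* (½ ℚ.* ε) ℚ.< ½ ℚ.* ε
  ¼ε<½ε = begin-strict
    ½ ℚ.* (½ ℚ.* ε)
      ≡⟨ ℚ.+-identityʳ _ ⟨
    ½ ℚ.* (½ ℚ.* ε) ℚ.+ 0ℚ
      <⟨ ℚ.+-monoʳ-< (½ ℚ.* (½ ℚ.* ε)) (½*ε>0 (½*ε>0 ε>0)) ⟩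
    ½ ℚ.* (½ ℚ.* ε) ℚ.+ ½ ℚ.* (½ ℚ.* ε)
      ≡⟨ ½*ε+½*ε≡ε (½ ℚ.* ε) ⟩
    ½ ℚ.* ε ∎
...   | no 0≮xₖ+½ε = contradiction (λ (0≤x : 0ℝ ≤ x) →
  let l , 0<x = 0≤x (½ ℚ.* (½ ℚ.* ε)) (½*ε>0 (½*ε>0 ε>0))
      i = k ℕ.⊔ l
  in 0≮xₖ+½ε (begin-strict
    0ℚ
      <⟨ 0<x i (ℕ.m≤n⊔m k l) ⟩
    seq x i ℚ.+ ½ ℚ.* (½ ℚ.* ε)
      <⟨ ℚ.+-monoˡ-< (½ ℚ.* (½ ℚ.* ε))
           (∣p-q∣<ε⇒p<q+ε (seq x i) (seq x k) (close i k (ℕ.m≤m⊔n k l) ℕ.≤-refl)) ⟩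
    seq x k ℚ.+ ½ ℚ.* (½ ℚ.* ε) ℚ.+ ½ ℚ.* (½ ℚ.* ε)
      ≡⟨ ℚ.+-assoc (seq x k) _ _ ⟩
    seq x k ℚ.+ (½ ℚ.* (½ ℚ.* ε) ℚ.+ ½ ℚ.* (½ ℚ.* ε))
      ≡⟨ cong (seq x k ℚ.+_) (½*ε+½*ε≡ε (½ ℚ.* ε)) ⟩
    seq x k ℚ.+ ½ ℚ.* ε ∎)) ¬¬0≤x
  where open ℚ.≤-Reasoning

-- Only finitely many terms occur, so their double negations can be removed one after another while
-- a contradiction is being derived.
¬¬-∑-cong : (f g : A → ℝ) → (∀ x → ¬ ¬ f x ≃ g x) → ∀ xs → ¬ ¬ ∑ xs f ≃ ∑ xs g
¬¬-∑-cong f g f≃g []       ¬≃ = ¬≃ (≃-refl {0ℝ})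
¬¬-∑-cong f g f≃g (x ∷ xs) ¬≃ = f≃g x λ fx≃gx → ¬¬-∑-cong f g f≃g xs λ ∑f≃∑g →
  ¬≃ (+-cong {f x} {g x} {∑ xs f} {∑ xs g} fx≃gx ∑f≃∑g)

-- Finite sums and enumerations

∑ℚ : List A → (A → ℚ) → ℚ
∑ℚ []       f = 0ℚ
∑ℚ (x ∷ xs) f = f x ℚ.+ ∑ℚ xs f

seq-∑ : ∀ (f : A → ℝ) i xs → seq (∑ xs f) i ≡ ∑ℚ xs (λ x → seq (f x) i)
seq-∑ f i []       = refl
seq-∑ f i (x ∷ xs) = cong (seq (f x) i ℚ.+_) (seq-∑ f i xs)

∑ℚ-cong : {f g : A → ℚ} → (∀ x → f x ≡ g x) → ∀ xs → ∑ℚ xs f ≡ ∑ℚ xs g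
∑ℚ-cong f≡g []       = refl
∑ℚ-cong f≡g (x ∷ xs) = cong₂ ℚ._+_ (f≡g x) (∑ℚ-cong f≡g xs)

∑ℚ-zero : (xs : List A) → ∑ℚ xs (λ _ → 0ℚ) ≡ 0ℚ
∑ℚ-zero []       = refl
∑ℚ-zero (x ∷ xs) = trans (ℚ.+-identityˡ _) (∑ℚ-zero xs)

∑ℚ-+ : ∀ (f g : A → ℚ) xs → ∑ℚ xs (λ x → f x ℚ.+ g x) ≡ ∑ℚ xs f ℚ.+ ∑ℚ xs g
∑ℚ-+ f g []       = refl
∑ℚ-+ f g (x ∷ xs) = trans (cong (f x ℚ.+ g x ℚ.+_) (∑ℚ-+ f g xs))
  (interchange (f x) (g x) (∑ℚ xs f) (∑ℚ xs g))
  where open CommutativeSemigroup (CommutativeMonoid.commutativeSemigroup ℚ.+-0-commutativeMonoid)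

∑ℚ-*ˡ : ∀ c (f : A → ℚ) xs → ∑ℚ xs (λ x → c ℚ.* f x) ≡ c ℚ.* ∑ℚ xs f
∑ℚ-*ˡ c f []       = sym (ℚ.*-zeroʳ c)
∑ℚ-*ˡ c f (x ∷ xs) = trans (cong (c ℚ.* f x ℚ.+_) (∑ℚ-*ˡ c f xs)) (sym (ℚ.*-distribˡ-+ c (f x) _))

∑ℚ-swap : ∀ (f : A → B → ℚ) xs ys →
          ∑ℚ ys (λ y → ∑ℚ xs (λ x → f x y)) ≡ ∑ℚ xs (λ x → ∑ℚ ys (f x))
∑ℚ-swap f []       ys = ∑ℚ-zero ys
∑ℚ-swap f (x ∷ xs) ys =
  trans (∑ℚ-+ (f x) (λ y → ∑ℚ xs (λ x → f x y)) ys) (cong (∑ℚ ys (f x) ℚ.+_) (∑ℚ-swap f xs ys))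

-- Turns a filtered sum into a sum over a list that does not depend on the predicate, so that two
-- summations can be exchanged.
𝟙 : {P : Set p} → Dec P → ℚ
𝟙 P? = if does P? then 1ℚ else 0ℚ

𝟙-true : {P : Set p} (P? : Dec P) → P → 𝟙 P? ≡ 1ℚ
𝟙-true P? x = cong (if_then 1ℚ else 0ℚ) (dec-true P? x)

𝟙-false : {P : Set p} (P? : Dec P) → ¬ P → 𝟙 P? ≡ 0ℚ
𝟙-false P? ¬x = cong (if_then 1ℚ else 0ℚ) (dec-false P? ¬x)

𝟙-cong : ∀ {q} {P : Set p} {Q : Set q} (P? : Dec P) (Q? : Dec Q) → P ⇔ Q → 𝟙 P? ≡ 𝟙 Q?
𝟙-cong P? Q? P⇔Q = cong (if_then 1ℚ else 0ℚ) (does-⇔ P⇔Q P? Q?)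

∑ℚ-filter : ∀ {P : Pred A p} (P? : Decidable P) f xs →
            ∑ℚ (filter P? xs) f ≡ ∑ℚ xs (λ x → f x ℚ.* 𝟙 (P? x))
∑ℚ-filter P? f []       = refl
∑ℚ-filter P? f (x ∷ xs) with P? x
... | yes _ = cong₂ ℚ._+_ (sym (ℚ.*-identityʳ (f x))) (∑ℚ-filter P? f xs)
... | no  _ = trans (∑ℚ-filter P? f xs)
  (sym (trans (cong (ℚ._+ _) (ℚ.*-zeroʳ (f x))) (ℚ.+-identityˡ _)))

∑ℚ-none : ∀ {P : Pred A p} (P? : Decidable P) (f : A → ℚ) xs →
          All (λ x → ¬ P x) xs → ∑ℚ xs (λ x → 𝟙 (P? x) ℚ.* f x) ≡ 0ℚ
∑ℚ-none P? f []       []         = refl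
∑ℚ-none P? f (x ∷ xs) (¬p ∷ ¬ps) = trans
  (cong₂ ℚ._+_ (trans (cong (ℚ._* f x) (𝟙-false (P? x) ¬p)) (ℚ.*-zeroˡ (f x))) (∑ℚ-none P? f xs ¬ps))
  (ℚ.+-identityˡ 0ℚ)

∑ℚ-single : ∀ {P : Pred A p} (P? : Decidable P) (f : A → ℚ) {xs x} → Unique xs → x List.∈ xs →
            P x → (∀ y → P y → x ≡ y) → ∑ℚ xs (λ x → 𝟙 (P? x) ℚ.* f x) ≡ f x
∑ℚ-single P? f {x ∷ xs} (x∉xs ∷ _) (here refl) px only = trans
  (cong₂ ℚ._+_ (trans (cong (ℚ._* f x) (𝟙-true (P? x) px)) (ℚ.*-identityˡ (f x)))
             (∑ℚ-none P? f xs (All.map (λ x≢y py → x≢y (only _ py)) x∉xs)))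
  (ℚ.+-identityʳ (f x))
∑ℚ-single P? f {y ∷ xs} {x} (y∉xs ∷ xs!) (there x∈xs) px only = trans
  (cong₂ ℚ._+_ (trans (cong (ℚ._* f y) (𝟙-false (P? y) ¬py)) (ℚ.*-zeroˡ (f y)))
             (∑ℚ-single P? f xs! x∈xs px only))
  (ℚ.+-identityˡ (f x))
  where
  ¬py : ¬ _
  ¬py py = All.lookup y∉xs x∈xs (sym (only y py))

-- Double counting over the related pairs. It serves twice: for edge weights collected along a
-- contraction, and for coefficients collected in a zero-lift.
∑ℚ-regroup : ∀ {R : A → B → Set p} (R? : ∀ x y → Dec (R x y))
             (f : A → ℚ) (g : B → ℚ) (h : A → ℚ) xs ys →
             (∀ x → ∑ℚ ys (λ y → 𝟙 (R? x y) ℚ.* g y) ≡ h x) →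
             ∑ℚ ys (λ y → ∑ℚ (filter (λ x → R? x y) xs) f ℚ.* g y) ≡ ∑ℚ xs (λ x → f x ℚ.* h x)
∑ℚ-regroup R? f g h xs ys total = begin
  ∑ℚ ys (λ y → ∑ℚ (filter (λ x → R? x y) xs) f ℚ.* g y)
    ≡⟨ ∑ℚ-cong expand ys ⟩
  ∑ℚ ys (λ y → ∑ℚ xs (λ x → f x ℚ.* (𝟙 (R? x y) ℚ.* g y)))
    ≡⟨ ∑ℚ-swap (λ x y → f x ℚ.* (𝟙 (R? x y) ℚ.* g y)) xs ys ⟩
  ∑ℚ xs (λ x → ∑ℚ ys (λ y → f x ℚ.* (𝟙 (R? x y) ℚ.* g y)))
    ≡⟨ ∑ℚ-cong (λ x → trans (∑ℚ-*ˡ (f x) _ ys) (cong (f x ℚ.*_) (total x))) xs ⟩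
  ∑ℚ xs (λ x → f x ℚ.* h x) ∎
  where
  open ≡-Reasoning
  expand : ∀ y → ∑ℚ (filter (λ x → R? x y) xs) f ℚ.* g y ≡ ∑ℚ xs (λ x → f x ℚ.* (𝟙 (R? x y) ℚ.* g y))
  expand y = begin
    ∑ℚ (filter (λ x → R? x y) xs) f ℚ.* g y       ≡⟨ cong (ℚ._* g y) (∑ℚ-filter (λ x → R? x y) f xs) ⟩
    ∑ℚ xs (λ x → f x ℚ.* 𝟙 (R? x y)) ℚ.* g y        ≡⟨ ℚ.*-comm _ (g y) ⟩
    g y ℚ.* ∑ℚ xs (λ x → f x ℚ.* 𝟙 (R? x y))        ≡⟨ ∑ℚ-*ˡ (g y) _ xs ⟨
    ∑ℚ xs (λ x → g y ℚ.* (f x ℚ.* 𝟙 (R? x y)))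
      ≡⟨ ∑ℚ-cong (λ x → trans (ℚ.*-comm (g y) _) (ℚ.*-assoc (f x) (𝟙 (R? x y)) (g y))) xs ⟩
    ∑ℚ xs (λ x → f x ℚ.* (𝟙 (R? x y) ℚ.* g y))      ∎

-- Enumerations are complete and free of repetitions

map-value-refine : ∀ {P : Pred A p} (P? : Decidable P) xs → map value (refine P? xs) ≡ filter P? xs
map-value-refine P? []       = refl
map-value-refine P? (x ∷ xs) with P? x
... | yes _ = cong (x ∷_) (map-value-refine P? xs)
... | no  _ = map-value-refine P? xs

refine⁺ : ∀ {P : Pred A p} (P? : Decidable P) {xs} → Unique xs → Unique (refine P? xs)
refine⁺ P? {xs} xs! = Unique.map⁻ (subst Unique (sym (map-value-refine P? xs)) (Unique.filter⁺ P? xs!))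

∈-refine : ∀ {P : Pred A p} (P? : Decidable P) {xs x} →
           x List.∈ xs → (px : P x) → (x , [ px ]) List.∈ refine P? xs
∈-refine P? {xs} {x} x∈xs px
  with ∈-map⁻ value (subst (x List.∈_) (sym (map-value-refine P? xs)) (∈-filter⁺ P? x∈xs px))
-- The proof component of a refinement is irrelevant, so equal values already make `y` the required
-- element.
... | y , y∈ , refl = y∈

∈-subsets : ∀ {n} (I : Subset n) → I List.∈ subsets n
∈-subsets []            = here refl
∈-subsets (outside ∷ I) = ∈-++⁺ˡ (∈-map⁺ (outside ∷_) (∈-subsets I))
∈-subsets (inside  ∷ I) = ∈-++⁺ʳ _ (∈-map⁺ (inside ∷_) (∈-subsets I))

subsets! : ∀ n → Unique (subsets n)
subsets! zero    = [] ∷ []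
subsets! (suc n) = Unique.++⁺ (Unique.map⁺ ∷-injectiveʳ (subsets! n))
  (Unique.map⁺ ∷-injectiveʳ (subsets! n)) disjoint-heads
  where
  disjoint-heads : Disjoint (map (outside ∷_) (subsets n)) (map (inside ∷_) (subsets n))
  disjoint-heads (I∈out , I∈in)
    with ∈-map⁻ (outside ∷_) I∈out | ∈-map⁻ (inside ∷_) I∈in
  ... | _ , _ , refl | _ , _ , ()

nonemptySubsets! : ∀ n → Unique (nonemptySubsets n)
nonemptySubsets! n = refine⁺ nonempty? (subsets! n)

∈-nonemptySubsets : ∀ {n} (I : Subset n) (ne : Nonempty I) → (I , [ ne ]) List.∈ nonemptySubsets n
∈-nonemptySubsets I ne = ∈-refine nonempty? (∈-subsets I) ne

edges! : ∀ N → Unique (edges N)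
edges! N = refine⁺ (λ e → proj₁ e <ᶠ? proj₂ e)
  (Unique.cartesianProduct⁺ (Unique.allFin⁺ N) (Unique.allFin⁺ N))

∈-edges : ∀ {N} {u v} u<v → ((u , v) , [ u<v ]) List.∈ edges N
∈-edges {u = u} {v} u<v =
  ∈-refine (λ e → proj₁ e <ᶠ? proj₂ e) (∈-cartesianProduct⁺ (∈-allFin u) (∈-allFin v)) u<v

-- Contractions of weighted graphs

lookup-injective : {I J : Subset n} → (∀ i → lookup I i ≡ lookup J i) → I ≡ J
lookup-injective {I = I} {J} I≗J =
  trans (sym (tabulate∘lookup I)) (trans (tabulate-cong I≗J) (tabulate∘lookup J))

∉⇒lookup≡outside : ∀ {I : Subset n} {i} → i ∉ I → lookup I i ≡ outside
∉⇒lookup≡outside {I = I} {i} i∉I = ¬-not (i∉I ∘ lookup⇒[]= i I)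

preimage : (Fin M → Fin N) → Subset N → Subset M
preimage φ W = tabulate (λ v → lookup W (φ v))

lookup-preimage : ∀ (φ : Fin M → Fin N) W v → lookup (preimage φ W) v ≡ lookup W (φ v)
lookup-preimage φ W v = lookup∘tabulate (λ v → lookup W (φ v)) v

∈-preimage⁺ : ∀ (φ : Fin M → Fin N) {W v} → φ v ∈ W → v ∈ preimage φ W
∈-preimage⁺ φ {W} {v} φv∈W =
  lookup⇒[]= v _ (trans (lookup-preimage φ W v) ([]=⇒lookup φv∈W))

∈-preimage⁻ : ∀ (φ : Fin M → Fin N) {W v} → v ∈ preimage φ W → φ v ∈ W
∈-preimage⁻ φ {W} {v} v∈φ⁻¹W =
  lookup⇒[]= (φ v) W (trans (sym (lookup-preimage φ W v)) ([]=⇒lookup v∈φ⁻¹W))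

-- Edges are stored with increasing endpoints, but `φ` may reverse the order; hence the two
-- orientations. An edge whose endpoints are merged lies over nothing.
Over : (Fin M → Fin N) → Edge M → Edge N → Set
Over φ ((u , v) , _) ((a , b) , _) = (φ u ≡ a × φ v ≡ b) ⊎ (φ u ≡ b × φ v ≡ a)

over? : ∀ (φ : Fin M → Fin N) d e → Dec (Over φ d e)
over? φ ((u , v) , _) ((a , b) , _) =
  (φ u Fin.≟ a ×-dec φ v Fin.≟ b) ⊎-dec (φ u Fin.≟ b ×-dec φ v Fin.≟ a)

Cut-over : ∀ (φ : Fin M → Fin N) W d e → Over φ d e → Cut W e ⇔ Cut (preimage φ W) d
Cut-over φ W d e (inj₁ (refl , refl)) = mk⇔
  (λ { (inj₁ (u∈ , v∉)) → inj₁ (∈-preimage⁺ φ u∈ , v∉ ∘ ∈-preimage⁻ φ)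
     ; (inj₂ (u∉ , v∈)) → inj₂ (u∉ ∘ ∈-preimage⁻ φ , ∈-preimage⁺ φ v∈) })
  (λ { (inj₁ (u∈ , v∉)) → inj₁ (∈-preimage⁻ φ u∈ , v∉ ∘ ∈-preimage⁺ φ)
     ; (inj₂ (u∉ , v∈)) → inj₂ (u∉ ∘ ∈-preimage⁺ φ , ∈-preimage⁻ φ v∈) })
Cut-over φ W d e (inj₂ (refl , refl)) = mk⇔
  (λ { (inj₁ (v∈ , u∉)) → inj₂ (u∉ ∘ ∈-preimage⁻ φ , ∈-preimage⁺ φ v∈)
     ; (inj₂ (v∉ , u∈)) → inj₁ (∈-preimage⁺ φ u∈ , v∉ ∘ ∈-preimage⁻ φ) })
  (λ { (inj₁ (u∈ , v∉)) → inj₂ (v∉ ∘ ∈-preimage⁺ φ , ∈-preimage⁻ φ u∈)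
     ; (inj₂ (u∉ , v∈)) → inj₁ (∈-preimage⁻ φ v∈ , u∉ ∘ ∈-preimage⁺ φ) })

-- The weight map of the quotient graph: weights of parallel edges add up and loops disappear.
pushforward : (Fin M → Fin N) → WeightMap M → WeightMap N
pushforward {M} φ w .weight e = ∑ (filter (λ d → over? φ d e) (edges M)) (weight w)
pushforward {M} φ w .nonNeg e = ∑-nonNeg (weight w) (nonNeg w) (filter (λ d → over? φ d e) (edges M))

-- If `φ` separates the endpoints of `d`, then `d` lies over exactly one edge, and `Cut-over`
-- compares the two cuts. Otherwise both sides are 0, as a preimage under `φ` cannot separate merged
-- endpoints.
over-cut : ∀ (φ : Fin M → Fin N) W d →
           ∑ℚ (edges N) (λ e → 𝟙 (over? φ d e) ℚ.* 𝟙 (cut? W e)) ≡ 𝟙 (cut? (preimage φ W) d)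
over-cut {N = N} φ W d@((u , v) , _) with Fin.<-cmp (φ u) (φ v)
... | tri< φu<φv _ φv≮φu = trans
  (∑ℚ-single (over? φ d) (𝟙 ∘ cut? W) (edges! N) (∈-edges φu<φv) (inj₁ (refl , refl)) unique)
  (𝟙-cong (cut? W image) (cut? (preimage φ W) d) (Cut-over φ W d image (inj₁ (refl , refl))))
  where
  image = (φ u , φ v) , [ φu<φv ]
  unique : ∀ e → Over φ d e → image ≡ e
  unique _               (inj₁ (refl , refl)) = refl
  -- The opposite orientation needs `φ v < φ u`; this evidence is irrelevant, but may still be used
  -- to reach a contradiction.
  unique (_ , [ φv<φu ]) (inj₂ (refl , refl)) = contradiction-irr φv<φu φv≮φu
... | tri≈ φu≮φv φu≡φv φv≮φu = trans
  (∑ℚ-none (over? φ d) (𝟙 ∘ cut? W) (edges N) (All.universal none (edges N)))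
  (sym (𝟙-false (cut? (preimage φ W) d) uncut))
  where
  none : ∀ e → ¬ Over φ d e
  none (_ , [ φu<φv ]) (inj₁ (refl , refl)) = contradiction-irr φu<φv φu≮φv
  none (_ , [ φv<φu ]) (inj₂ (refl , refl)) = contradiction-irr φv<φu φv≮φu
  uncut : ¬ Cut (preimage φ W) d
  uncut (inj₁ (u∈ , v∉)) = v∉ (∈-preimage⁺ φ (subst (_∈ W) φu≡φv (∈-preimage⁻ φ u∈)))
  uncut (inj₂ (u∉ , v∈)) = u∉ (∈-preimage⁺ φ (subst (_∈ W) (sym φu≡φv) (∈-preimage⁻ φ v∈)))
... | tri> φu≮φv _ φv<φu = trans
  (∑ℚ-single (over? φ d) (𝟙 ∘ cut? W) (edges! N) (∈-edges φv<φu) (inj₂ (refl , refl)) unique)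
  (𝟙-cong (cut? W image) (cut? (preimage φ W) d) (Cut-over φ W d image (inj₂ (refl , refl))))
  where
  image = (φ v , φ u) , [ φv<φu ]
  unique : ∀ e → Over φ d e → image ≡ e
  unique (_ , [ φu<φv ]) (inj₁ (refl , refl)) = contradiction-irr φu<φv φu≮φv
  unique _               (inj₂ (refl , refl)) = refl

-- Each old edge passes its weight to the edge it lies over, so after exchanging the sums it is
-- counted exactly when the preimage of `W` cuts it.
cutWeight-pushforward : ∀ (φ : Fin M → Fin N) w W →
                        cutWeight (pushforward φ w) W ≐ cutWeight w (preimage φ W)
cutWeight-pushforward {M} {N} φ w W i = begin
  seq (cutWeight (pushforward φ w) W) i
    ≡⟨ seq-∑ (weight (pushforward φ w)) i (filter (cut? W) (edges N)) ⟩
  ∑ℚ (filter (cut? W) (edges N)) (λ e → seq (weight (pushforward φ w) e) i)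
    ≡⟨ ∑ℚ-filter (cut? W) (λ e → seq (weight (pushforward φ w) e) i) (edges N) ⟩
  ∑ℚ (edges N) (λ e → seq (weight (pushforward φ w) e) i ℚ.* 𝟙 (cut? W e))
    ≡⟨ ∑ℚ-cong (λ e → cong (ℚ._* 𝟙 (cut? W e))
         (seq-∑ (weight w) i (filter (λ d → over? φ d e) (edges M)))) (edges N) ⟩
  ∑ℚ (edges N) (λ e → ∑ℚ (filter (λ d → over? φ d e) (edges M)) wᵢ ℚ.* 𝟙 (cut? W e))
    ≡⟨ ∑ℚ-regroup (over? φ) wᵢ (𝟙 ∘ cut? W) (𝟙 ∘ cut? (preimage φ W))
         (edges M) (edges N) (over-cut φ W) ⟩
  ∑ℚ (edges M) (λ d → wᵢ d ℚ.* 𝟙 (cut? (preimage φ W) d))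
    ≡⟨ ∑ℚ-filter (cut? (preimage φ W)) wᵢ (edges M) ⟨
  ∑ℚ (filter (cut? (preimage φ W)) (edges M)) wᵢ
    ≡⟨ seq-∑ (weight w) i (filter (cut? (preimage φ W)) (edges M)) ⟨
  seq (cutWeight w (preimage φ W)) i ∎
  where
  open ≡-Reasoning
  wᵢ : Edge M → ℚ
  wᵢ d = seq (weight w d) i

-- The admissible sets for I = ∅ include ∅, whose cut is empty; hence S_∅ = 0.

extend? : (S : Vector n) (I : Subset n) → Dec (Nonempty I) → ℝ
extend? S I (yes I≢∅) = S (I , [ I≢∅ ])
extend? S I (no  _)   = 0ℝ

extend : Vector n → Subset n → ℝ
extend S I = extend? S I (nonempty? I)

truncate-⊥ : (n≤N : n ≤ℕ N) → truncate n≤N ⊥ ≡ ⊥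
truncate-⊥ n≤N = Empty-unique λ (i , i∈) → ∉⊥ (lookup⇒[]= (inject≤ i n≤N) ⊥
  (trans (sym (lookup-truncate n≤N ⊥ i)) ([]=⇒lookup i∈)))

cutWeight-⊥ : (w : WeightMap N) → cutWeight w ⊥ ≡ 0ℝ
cutWeight-⊥ {N} w = cong (λ es → ∑ es (weight w))
  (filter-none (cut? ⊥) (All.universal uncut (edges N)))
  where
  uncut : ∀ e → ¬ Cut ⊥ e
  uncut e (inj₁ (u∈⊥ , _)) = ∉⊥ u∈⊥
  uncut e (inj₂ (_ , v∈⊥)) = ∉⊥ v∈⊥

extend-realizes : ∀ (n<N : n < N) w S → Realizes n<N w S →
                  ∀ I → IsMin (Admissible n<N I) (cutWeight w) (extend S I)
extend-realizes {n} {N} n<N w S real I = minimum (nonempty? I)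
  where
  -- The decision is made an argument so that `extend?` reduces in each case.
  minimum : ∀ I≢∅? → IsMin (Admissible n<N I) (cutWeight w) (extend? S I I≢∅?)
  minimum (yes I≢∅) = real (I , [ I≢∅ ])
  minimum (no  I≡∅) =
    (⊥ , ((λ v v∈⊥ → contradiction v∈⊥ ∉⊥) ,
          trans (truncate-⊥ (ℕ.<⇒≤ n<N)) (sym (Empty-unique I≡∅))) ,
     ≐⇒≃ {0ℝ} {cutWeight w ⊥} (λ i → cong (λ x → seq x i) (sym (cutWeight-⊥ w)))) ,
    λ W _ → ∑-nonNeg (weight w) (nonNeg w) (filter (cut? W) (edges N))

-- The trace on the old terminals of a set with trace `I` on the new ones. `nothing` stands for the
-- sink, which lies outside every admissible set.
pull : (Fin m → Maybe (Fin n)) → Subset n → Subset m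
pull ρ I = tabulate (λ j → maybe (lookup I) outside (ρ j))

lookup-pull : ∀ (ρ : Fin m → Maybe (Fin n)) I j →
              lookup (pull ρ I) j ≡ maybe (lookup I) outside (ρ j)
lookup-pull ρ I j = lookup∘tabulate (λ j → maybe (lookup I) outside (ρ j)) j

-- ρ j = just i contracts the old terminal j to the new terminal i, and
-- ρ j = nothing contracts it to the sink. The contracted graph keeps all the
-- vertices, so that those outside the image of φ become isolated.

module Contraction (n≤m : n ≤ℕ m) (m<N : m < suc N) (ρ : Fin m → Maybe (Fin n)) where

  n<N : n < suc N
  n<N = ℕ.≤-<-trans n≤m m<N

  terminal : Maybe (Fin n) → Fin (suc N)
  terminal = maybe (λ i → inject≤ i (ℕ.<⇒≤ n<N)) (fromℕ N)

  φ : Fin (suc N) → Fin (suc N)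
  φ v with toℕ v ℕ.<? m
  ... | yes v<m = terminal (ρ (fromℕ< v<m))
  ... | no  _   = v

  φ-terminal : ∀ j → φ (inject≤ j (ℕ.<⇒≤ m<N)) ≡ terminal (ρ j)
  φ-terminal j with toℕ (inject≤ j (ℕ.<⇒≤ m<N)) ℕ.<? m
  ... | yes j<m = cong (terminal ∘ ρ) (toℕ-injective (trans (toℕ-fromℕ< j<m) (toℕ-inject≤ j _)))
  ... | no  j≮m = contradiction (subst (_< m) (sym (toℕ-inject≤ j _)) (toℕ<n j)) j≮m

  φ-nonterminal : ∀ {v} → ¬ toℕ v < m → φ v ≡ v
  φ-nonterminal {v} v≮m with toℕ v ℕ.<? m
  ... | yes v<m = contradiction v<m v≮m
  ... | no  _   = refl

  sink-outside : ∀ {k} {I : Subset k} (k<N : k < suc N) {W : Subset (suc N)} →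
                 Admissible k<N I W → lookup W (fromℕ N) ≡ outside
  sink-outside _ (W⊆ , _) = ∉⇒lookup≡outside λ sink∈W →
    ℕ.<-irrefl (cong suc (toℕ-fromℕ N)) (W⊆ (fromℕ N) sink∈W)

  lookup-terminal : ∀ {k} {I : Subset k} (k<N : k < suc N) {W : Subset (suc N)} →
                    truncate (ℕ.<⇒≤ k<N) W ≡ I →
                    ∀ i → lookup W (inject≤ i (ℕ.<⇒≤ k<N)) ≡ lookup I i
  lookup-terminal k<N {W} refl i = sym (lookup-truncate (ℕ.<⇒≤ k<N) W i)

  preimage-terminal : ∀ {I W} → Admissible n<N I W →
    ∀ j → lookup (preimage φ W) (inject≤ j (ℕ.<⇒≤ m<N)) ≡ lookup (pull ρ I) j
  preimage-terminal {I} {W} adm@(_ , W∩n≡I) j = begin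
    lookup (preimage φ W) (inject≤ j _)   ≡⟨ lookup-preimage φ W (inject≤ j _) ⟩
    lookup W (φ (inject≤ j _))            ≡⟨ cong (lookup W) (φ-terminal j) ⟩
    lookup W (terminal (ρ j))             ≡⟨ at (ρ j) ⟩
    maybe (lookup I) outside (ρ j)        ≡⟨ lookup-pull ρ I j ⟨
    lookup (pull ρ I) j                   ∎
    where
    open ≡-Reasoning
    at : ∀ i → lookup W (terminal i) ≡ maybe (lookup I) outside i
    at (just i) = lookup-terminal n<N W∩n≡I i
    at nothing  = sink-outside n<N adm

  -- With `cutWeight-pushforward`, this bounds every admissible cut of the contracted graph below by
  -- the old minimum.
  preimage-admissible : ∀ {I W} → Admissible n<N I W → Admissible m<N (pull ρ I) (preimage φ W)
  preimage-admissible {I} {W} adm@(W⊆ , _) = below , lookup-injective λ j →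
    trans (lookup-truncate _ (preimage φ W) j) (preimage-terminal adm j)
    where
    below : ∀ v → v ∈ preimage φ W → suc (toℕ v) < suc N
    below v v∈ with toℕ v ℕ.<? m
    ... | yes v<m = ℕ.≤-<-trans v<m m<N
    ... | no  v≮m = W⊆ v (subst (_∈ W) (φ-nonterminal v≮m) (∈-preimage⁻ φ v∈))

  replaceSide : Subset n → Subset (suc N) → Fin (suc N) → Side
  replaceSide I W v with toℕ v ℕ.<? n
  ... | yes v<n = lookup I (fromℕ< v<n)
  ... | no  _   = lookup W v

  -- Carries an old minimizer to the contracted graph. Only the first `n` positions, those of the
  -- new terminals, are overwritten; positions from `n` up to `m` lie outside the image of `φ`, so
  -- their sides do not affect the preimage.
  replace : Subset n → Subset (suc N) → Subset (suc N)
  replace I W = tabulate (replaceSide I W)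

  replace-terminal : ∀ I W i → lookup (replace I W) (inject≤ i (ℕ.<⇒≤ n<N)) ≡ lookup I i
  replace-terminal I W i = trans (lookup∘tabulate (replaceSide I W) (inject≤ i _)) at
    where
    at : replaceSide I W (inject≤ i (ℕ.<⇒≤ n<N)) ≡ lookup I i
    at with toℕ (inject≤ i (ℕ.<⇒≤ n<N)) ℕ.<? n
    ... | yes i<n = cong (lookup I) (toℕ-injective (trans (toℕ-fromℕ< i<n) (toℕ-inject≤ i _)))
    ... | no  i≮n = contradiction (subst (_< n) (sym (toℕ-inject≤ i _)) (toℕ<n i)) i≮n

  replace-nonterminal : ∀ I W {v} → ¬ toℕ v < n → lookup (replace I W) v ≡ lookup W v
  replace-nonterminal I W {v} v≮n = trans (lookup∘tabulate (replaceSide I W) v) at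
    where
    at : replaceSide I W v ≡ lookup W v
    at with toℕ v ℕ.<? n
    ... | yes v<n = contradiction v<n v≮n
    ... | no  _   = refl

  replace-admissible : ∀ {I J W} → Admissible m<N J W → Admissible n<N I (replace I W)
  replace-admissible {I} {J} {W} (W⊆ , _) = below , lookup-injective λ i →
    trans (lookup-truncate _ (replace I W) i) (replace-terminal I W i)
    where
    below : ∀ v → v ∈ replace I W → suc (toℕ v) < suc N
    below v v∈ with toℕ v ℕ.<? n
    ... | yes v<n = ℕ.≤-<-trans v<n n<N
    ... | no  v≮n = W⊆ v (lookup⇒[]= v W
      (trans (sym (replace-nonterminal I W v≮n)) ([]=⇒lookup v∈)))

  -- On old terminals both sides have trace `pull ρ I`. On the other vertices `φ` is the identity
  -- and, as `n ≤ m`, `replace` changes nothing.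
  preimage-replace : ∀ {I W} → Admissible m<N (pull ρ I) W → preimage φ (replace I W) ≡ W
  preimage-replace {I} {W} adm@(_ , W∩m≡ρI) = lookup-injective agree
    where
    agree : ∀ v → lookup (preimage φ (replace I W)) v ≡ lookup W v
    agree v with toℕ v ℕ.<? m
    ... | yes v<m = subst (λ v → lookup (preimage φ (replace I W)) v ≡ lookup W v)
      (toℕ-injective (trans (toℕ-inject≤ j _) (toℕ-fromℕ< v<m)))
      (trans (preimage-terminal (replace-admissible adm) j)
             (sym (lookup-terminal m<N W∩m≡ρI j)))
      where j = fromℕ< v<m
    ... | no  v≮m = trans (lookup-preimage φ (replace I W) v) (trans
      (cong (lookup (replace I W)) (φ-nonterminal v≮m))
      (replace-nonterminal I W (v≮m ∘ λ v<n → ℕ.<-≤-trans v<n n≤m)))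

  contract-realizes : ∀ w S → Realizes m<N w S →
    Realizes n<N (pushforward φ w) (λ I → extend S (pull ρ (value I)))
  contract-realizes w S real I =
    minimum {extend S (pull ρ (value I))} (extend-realizes m<N w S real (pull ρ (value I)))
    where
    minimum : ∀ {x} → IsMin (Admissible m<N (pull ρ (value I))) (cutWeight w) x →
              IsMin (Admissible n<N (value I)) (cutWeight (pushforward φ w)) x
    minimum {x} ((W , W-adm , x≃) , x≤) =
      -- The minimum is attained at the transported old minimizer, whose cut keeps its weight.
      (replace (value I) W , replace-admissible W-adm ,
       ≃-trans {x} {cutWeight w W} {cutWeight (pushforward φ w) (replace (value I) W)} x≃
         (≐⇒≃ {cutWeight w W} {cutWeight (pushforward φ w) (replace (value I) W)} λ i → sym (trans
           (cutWeight-pushforward φ w (replace (value I) W) i)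
           (cong (λ V → seq (cutWeight w V) i) (preimage-replace W-adm))))) ,
      λ V V-adm → ≤-respʳ-≐ {cutWeight w (preimage φ V)} {cutWeight (pushforward φ w) V} {x}
        (λ i → sym (cutWeight-pushforward φ w V i))
        (x≤ (preimage φ V) (preimage-admissible V-adm))

H-pull : n ≤ℕ m → (ρ : Fin m → Maybe (Fin n)) → ∀ S → H m S → H n (λ I → extend S (pull ρ (value I)))
-- The bound `m<N` excludes a graph with no vertices, so a last vertex is available as the sink.
H-pull n≤m ρ S (suc N , m<N , w , real) =
  suc N , n<N , pushforward φ w , contract-realizes w S real
  where open Contraction n≤m m<N ρ

-- Zero-lifts

∈-⋃⁺ : ∀ {Is : List (Subset n)} {I j} → I List.∈ Is → j ∈ I → j ∈ ⋃ Is
∈-⋃⁺ (here refl)  j∈I = x∈p∪q⁺ (inj₁ j∈I)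
∈-⋃⁺ (there I∈Is) j∈I = x∈p∪q⁺ (inj₂ (∈-⋃⁺ I∈Is j∈I))

∈-⋃⁻ : ∀ (Is : List (Subset n)) {j} → j ∈ ⋃ Is → ∃[ I ] I List.∈ Is × j ∈ I
∈-⋃⁻ []       j∈⊥ = contradiction j∈⊥ ∉⊥
∈-⋃⁻ (I ∷ Is) j∈  with x∈p∪q⁻ I (⋃ Is) j∈
... | inj₁ j∈I  = I , here refl , j∈I
... | inj₂ j∈Is = let J , J∈Is , j∈J = ∈-⋃⁻ Is j∈Is in J , there J∈Is , j∈J

∈-⋃[]⁺ : ∀ (F : Fin n → Subset m) {I i j} → i ∈ I → j ∈ F i → j ∈ ⋃[ I ] F
∈-⋃[]⁺ F {I} i∈I j∈Fi = ∈-⋃⁺ (∈-map⁺ F (∈-filter⁺ (_∈? I) (∈-allFin _) i∈I)) j∈Fi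

∈-⋃[]⁻ : ∀ (F : Fin n → Subset m) I {j} → j ∈ ⋃[ I ] F → ∃[ i ] i ∈ I × j ∈ F i
∈-⋃[]⁻ F I j∈ with ∈-⋃⁻ (map F (filter (_∈? I) (allFin _))) j∈
... | _ , Fi∈ , j∈Fi with ∈-map⁻ F Fi∈
...   | i , i∈ , refl = i , proj₂ (∈-filter⁻ (_∈? I) {xs = allFin _} i∈) , j∈Fi

module _ {q : Vector n} (F : LiftFamily q) (appears? : ∀ i → Dec (Appears q i)) where

  private
    owner? : ∀ j → Dec (∃[ i ] Appears q i × j ∈ family F i)
    owner? j = Fin.any? (λ i → appears? i ×-dec j ∈? family F i)

  -- Restricted to terminals that appear, since only their sets are known to be disjoint; this makes
  -- the owner unique. Old terminals without an owner go to the sink.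
  owner : Fin (suc n) → Maybe (Fin n)
  owner j with owner? j
  ... | yes (i , _) = just i
  ... | no  _       = nothing

  pull-owner : ∀ I → (∀ {i} → i ∈ I → Appears q i) → pull owner I ≡ ⋃[ I ] family F
  pull-owner I appears = ⊆-antisym pull⊆⋃ ⋃⊆pull
    where
    pull⊆⋃ : ∀ {j} → j ∈ pull owner I → j ∈ ⋃[ I ] family F
    pull⊆⋃ {j} j∈ with trans (sym (lookup-pull owner I j)) ([]=⇒lookup j∈)
    ... | inside≡ with owner? j
    -- Without an owner, `inside≡` would equate `outside` with `inside`, so this is the only case.
    ...   | yes (i , _ , j∈Fi) = ∈-⋃[]⁺ (family F) (lookup⇒[]= i I inside≡) j∈Fi
    ⋃⊆pull : ∀ {j} → j ∈ ⋃[ I ] family F → j ∈ pull owner I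
    ⋃⊆pull {j} j∈ = lookup⇒[]= j _ (trans (lookup-pull owner I j) at)
      where
      at : maybe (lookup I) outside (owner j) ≡ inside
      at with ∈-⋃[]⁻ (family F) I j∈
      ... | i , i∈I , j∈Fi with owner? j
      -- The terminal `i` appears and its set contains `j`, so an owner exists; by disjointness it
      -- is `i` itself.
      ...   | no ∄ = contradiction (i , appears i∈I , j∈Fi) ∄
      ...   | yes (k , k-appears , j∈Fk) with k Fin.≟ i
      ...     | yes refl = []=⇒lookup i∈I
      ...     | no  k≢i  = contradiction (j , x∈p∩q⁺ (j∈Fk , j∈Fi))
        (disjoint F k i k-appears (appears i∈I) k≢i)

-- The indicator selects the single `K` with value `J`. For empty `J` there is none, which matches
-- the value 0 given by `extend`.
∑-extend : ∀ (S : Vector n) J i →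
  ∑ℚ (nonemptySubsets n) (λ K → 𝟙 (≡-dec _≟ᵇ_ J (value K)) ℚ.* seq (S K) i) ≡ seq (extend S J) i
∑-extend {n} S J i = total (nonempty? J)
  where
  J≟_ : ∀ (K : NonemptySubset n) → Dec (J ≡ value K)
  J≟ K = ≡-dec _≟ᵇ_ J (value K)
  total : ∀ J≢∅? → ∑ℚ (nonemptySubsets n) (λ K → 𝟙 (J≟ K) ℚ.* seq (S K) i) ≡ seq (extend? S J J≢∅?) i
  total (yes J≢∅) = ∑ℚ-single J≟_ (λ K → seq (S K) i)
    (nonemptySubsets! n) (∈-nonemptySubsets J J≢∅) refl (λ _ → value-injective)
  total (no  J≡∅) = ∑ℚ-none J≟_ (λ K → seq (S K) i) (nonemptySubsets n)
    (All.universal (λ { (_ , [ K≢∅ ]) refl → contradiction-irr K≢∅ J≡∅ }) (nonemptySubsets n))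

-- The coefficient at `J` collects the `q I` whose union is `J`. Regrouping by `I` undoes this; an
-- empty union matches no `J` and contributes 0 on both sides.
∑-zeroLift : ∀ (q : Vector n) F S →
  ∑ (nonemptySubsets n) (λ I → q I * extend S (⋃[ value I ] family F)) ≐
  ∑ (nonemptySubsets (suc n)) (λ J → zeroLift q F J * S J)
∑-zeroLift {n} q F S i = sym (begin
  seq (∑ (nonemptySubsets (suc n)) (λ J → zeroLift q F J * S J)) i
    ≡⟨ seq-∑ (λ J → zeroLift q F J * S J) i (nonemptySubsets (suc n)) ⟩
  ∑ℚ (nonemptySubsets (suc n)) (λ J → seq (zeroLift q F J) i ℚ.* seq (S J) i)
    ≡⟨ ∑ℚ-cong (λ J → cong (ℚ._* seq (S J) i)
         (seq-∑ q i (filter (λ I → lifts? I J) (nonemptySubsets n)))) (nonemptySubsets (suc n)) ⟩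
  ∑ℚ (nonemptySubsets (suc n)) (λ J →
    ∑ℚ (filter (λ I → lifts? I J) (nonemptySubsets n)) (λ I → seq (q I) i) ℚ.* seq (S J) i)
    ≡⟨ ∑ℚ-regroup lifts? (λ I → seq (q I) i) (λ J → seq (S J) i) _
         (nonemptySubsets n) (nonemptySubsets (suc n))
         (λ I → ∑-extend S (⋃[ value I ] family F) i) ⟩
  ∑ℚ (nonemptySubsets n) (λ I → seq (q I) i ℚ.* seq (extend S (⋃[ value I ] family F)) i)
    ≡⟨ seq-∑ (λ I → q I * extend S (⋃[ value I ] family F)) i (nonemptySubsets n) ⟨
  seq (∑ (nonemptySubsets n) (λ I → q I * extend S (⋃[ value I ] family F))) i ∎)
  where
  open ≡-Reasoning
  lifts? : ∀ (I : NonemptySubset n) (J : NonemptySubset (suc n)) →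
           Dec (⋃[ value I ] family F ≡ value J)
  lifts? I J = ≡-dec _≟ᵇ_ (⋃[ value I ] family F) (value J)

-- Comparison of the contracted vector with the zero-lift

module _ {q : Vector n} (F : LiftFamily q) (S : Vector (suc n)) where

  lifted : ℝ
  lifted = ∑ (nonemptySubsets n) (λ I → q I * extend S (⋃[ value I ] family F))

  module _ (appears? : ∀ i → Dec (Appears q i)) where

    contracted : Vector n
    contracted I = extend S (pull (owner F appears?) (value I))

    -- If `q I` vanishes, so do both products, whatever the second factors are. If not, `I` itself
    -- witnesses that each of its terminals appears, and `pull-owner` identifies the two index sets.
    contracted≃lifted : ∀ I → ¬ ¬ q I * contracted I ≃ q I * extend S (⋃[ value I ] family F)
    contracted≃lifted I = ¬¬-map by-cases ¬¬-excluded-middle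
      where
      T = extend S (⋃[ value I ] family F)
      by-cases : Dec (q I ≃ 0ℝ) → q I * contracted I ≃ q I * T
      by-cases (yes q≃0) = ≃-trans {q I * contracted I} {0ℝ} {q I * T}
        (*-zeroˡ {q I} {contracted I} q≃0)
        (≃-sym {q I * T} {0ℝ} (*-zeroˡ {q I} {T} q≃0))
      by-cases (no q≄0) = ≐⇒≃ {q I * contracted I} {q I * T} λ i →
        cong (λ J → seq (q I) i ℚ.* seq (extend S J) i)
          (pull-owner F appears? (value I) (λ i∈I → I , i∈I , q≄0))

    lifted-nonNeg : Valid n q → H (suc n) S → ¬ ¬ 0ℝ ≤ lifted
    lifted-nonNeg valid S∈H = ¬¬-map
      (λ ∑≃lifted → ≤-respʳ-≃ {∑ (nonemptySubsets n) (λ I → q I * contracted I)} {lifted} {0ℝ}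
        ∑≃lifted (valid contracted (H-pull (ℕ.n≤1+n n) (owner F appears?) S S∈H)))
      (¬¬-∑-cong (λ I → q I * contracted I) (λ I → q I * extend S (⋃[ value I ] family F))
        contracted≃lifted (nonemptySubsets n))

proposition6 : (n : ℕ) → 1 ≤ℕ n → (q : Vector n) → Valid n q →
    (F : LiftFamily q) → Valid (suc n) (zeroLift q F)
proposition6 n _ q valid F S S∈H =
  ≤-respʳ-≐ {lifted F S} {∑ (nonemptySubsets (suc n)) (λ J → zeroLift q F J * S J)} {0ℝ}
    (∑-zeroLift q F S)
    (0≤-stable {lifted F S} (negated-stable (¬¬-map
      (λ appears? → lifted-nonNeg F S appears? valid S∈H)
      -- There are finitely many terminals, so the double negation moves outside the quantifier and
      -- yields all decisions at once.
      (sequence (RawMonad.rawApplicative ¬¬-Monad) (λ _ → ¬¬-excluded-middle)))))
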